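{- Let $p\ge 1$, let $S$ be a subdivided star with $\ell\ge 2$ leaves, let $\lambda$ be a $p$-periodic 1-labeling of $S$, and let $\mathcal{S}=(S,\lambda)$. Then $\max(1,\ell-p)\le M_p(\mathcal{S})\le \ell-1$. Both bounds are tight: for all $\ell\ge 2$ and $p\ge 1$ each of the two bounds is attained by some subdivided star with $\ell$ leaves and some $p$-periodic 1-labeling of it.
   Context: A subdivided star is a tree obtained from a star by subdividing its edges, each an arbitrary number (possibly zero) of times. A $p$-periodic 1-labeling $\lambda$ of a finite simple undirected graph $G=(V,E)$ assigns to each edge $e$ an infinite set of time-steps of the form $\{i,i+p,i+2p,\dots\}$ with $i\in\{1,\dots,p\}$ (so each edge is present exactly once in every $p$ consecutive time-steps). In the temporal graph $\mathcal{G}=(G,\lambda)$, a journey from $u$ to $v$ is a path in $G$ from $u$ to $v$ together with a choice, for each edge of the path, of a time-step in its label set so that the chosen time-steps are strictly increasing along the path. The temporal distance $\mathrm{dist}_t(u,v)$ is the smallest time-step at which a journey from $u$ reaches $v$ (with $\mathrm{dist}_t(u,u)=0$, and $\infty$ if there is no journey). A set $R\subseteq V$ is a temporal resolving set if (i) for every $v\in V$ there is a journey from some $s\in R$ to $v$ (every vertex is reached from itself), and (ii) for every two distinct $u,v\in V$ there is $s\in R$ with $\mathrm{dist}_t(s,u)\neq\mathrm{dist}_t(s,v)$. $M_p(\mathcal{G})$ denotes the minimum size of a temporal resolving set of $\mathcal{G}$. -}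

module Defs where

open import Data.Fin using (Fin; zero; suc; inject₁)
open import Data.Fin.Subset using (Subset; _∈_; ∣_∣)
open import Data.List using (List; []; _∷_)
open import Data.List.Relation.Unary.Unique.Propositional using (Unique)
open import Data.Nat using (ℕ; suc; _+_; _*_; _≤_; _<_; _≟_)
open import Data.Product using (Σ-syntax; ∃-syntax; ∃₂; _×_)
open import Data.Vec using (allFin; count)
open import Function.Bundles using (_⇔_; _↔_; Inverse)
open import Level using (0ℓ)
open import Relation.Binary.Construct.Closure.Symmetric using (SymClosure)
open import Relation.Binary.Core using (Rel)
open import Relation.Binary.Definitions using (Decidable; Irreflexive; Symmetric)
open import Relation.Binary.PropositionalEquality using (_≡_; _≢_)
open import Relation.Nullary using (¬_)
open import Relation.Nullary.Construct.Add.Supremum using (_⁺; [_]; ⊤⁺)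
open import Relation.Unary using (Pred; _≐_)

record Graph : Set₁ where
  infix 4 _~_ _~?_
  field
    order    : ℕ
    _~_      : Rel (Fin order) 0ℓ
    _~?_     : Decidable _~_
    ~-sym    : Symmetric _~_
    ~-irrefl : Irreflexive _≡_ _~_

  Vertex : Set
  Vertex = Fin order

  degree : Vertex → ℕ
  degree v = count (v ~?_) (allFin order)

  leafCount : ℕ
  leafCount = count (λ v → degree v ≟ 1) (allFin order)

-- The star with m edges, its i-th edge subdivided s i times: that edge becomes
-- a path from the centre through the vertices on i 0, …, on i (s i).
module _ {m : ℕ} (s : Fin m → ℕ) where

  data StarVertex : Set where
    centre : StarVertex
    on     : (i : Fin m) → Fin (suc (s i)) → StarVertex

  data StarLink : Rel StarVertex 0ℓ where
    spoke : ∀ i → StarLink centre (on i zero)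
    next  : ∀ i (j : Fin (s i)) → StarLink (on i (inject₁ j)) (on i (suc j))

  StarAdjacent : Rel StarVertex 0ℓ
  StarAdjacent = SymClosure StarLink

-- The number m of edges of the star is not the number of leaves when m = 1,
-- since the centre is then a leaf as well.
record IsSubdividedStar (G : Graph) : Set where
  open Graph G
  field
    edges        : ℕ
    subdivisions : Fin edges → ℕ
    vertices     : StarVertex subdivisions ↔ Vertex
    adjacency    : ∀ x y → StarAdjacent subdivisions x y ⇔
                           (Inverse.to vertices x ~ Inverse.to vertices y)

-- Since e and e′ are arbitrary, label-sym also makes the label set independent
-- of the proof of adjacency: label is a function of the undirected edge.
record Labelling (G : Graph) : Set₁ where
  open Graph G
  field
    label     : ∀ {u v} → u ~ v → Pred ℕ 0ℓ
    label-sym : ∀ {u v} (e : u ~ v) (e′ : v ~ u) → label e ≐ label e′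

IsPeriodic1Labelling : ℕ → {G : Graph} → Labelling G → Set
IsPeriodic1Labelling p {G} Λ =
  ∀ {u v} (e : u ~ v) →
    ∃[ i ] (1 ≤ i × i ≤ p × label e ≐ (λ t → ∃[ k ] t ≡ i + k * p))
  where
  open Graph G
  open Labelling Λ

module Temporal {G : Graph} (Λ : Labelling G) where
  open Graph G
  open Labelling Λ

  -- TimedWalk u v t: a walk from u to v with strictly increasing time-steps, the
  -- last of which is t.  Giving the empty walk the time 0 yields dist(u,u) = 0;
  -- it constrains nothing else, as time-steps are positive.
  data TimedWalk (u : Vertex) : Vertex → ℕ → Set where
    stay : TimedWalk u u 0
    step : ∀ {w v t t′} → TimedWalk u w t → (e : w ~ v) →
           label e t′ → t < t′ → TimedWalk u v t′

  visited : ∀ {u v t} → TimedWalk u v t → List Vertex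
  visited {v = v} stay           = v ∷ []
  visited {v = v} (step W _ _ _) = v ∷ visited W

  Journey : Vertex → Vertex → ℕ → Set
  Journey u v t = Σ[ W ∈ TimedWalk u v t ] Unique (visited W)

  -- IsDist u v d: the temporal distance from u to v is d, where ⊤⁺ is ∞.
  IsDist : Vertex → Vertex → ℕ ⁺ → Set
  IsDist u v [ t ] = Journey u v t × (∀ t′ → Journey u v t′ → t ≤ t′)
  IsDist u v ⊤⁺    = ∀ t → ¬ Journey u v t

  Resolves : Vertex → Vertex → Vertex → Set
  Resolves s u v = ∃₂ λ d d′ → IsDist s u d × IsDist s v d′ × d ≢ d′

  record IsResolvingSet (R : Subset order) : Set where
    field
      reaches  : ∀ v → ∃[ s ] (s ∈ R × ∃[ t ] Journey s v t)
      resolves : ∀ u v → u ≢ v → ∃[ s ] (s ∈ R × Resolves s u v)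

  -- IsM m: the minimum size of a temporal resolving set is m.
  IsM : ℕ → Set
  IsM m = (∃[ R ] (IsResolvingSet R × ∣ R ∣ ≡ m))
        × (∀ R → IsResolvingSet R → m ≤ ∣ R ∣)

{-# OPTIONS --safe #-}
-- A vertex u ≠ v through which every walk from s to v must pass is reached from s
-- strictly before v.  Hence the tips of all arms but one (the centre, if there is
-- only one arm) form a resolving set: the tip of an arm tells the vertices of that
-- arm from all others, and any tip tells apart the vertices of the remaining arm
-- and the centre.
-- Conversely, two arms without a member of R whose spokes carry the same labels
-- have first vertices at equal distance from each member of R.  So each arm is
-- determined by a member of R on it or by one of the p offsets, and the number of
-- arms is at most |R| + p.  The upper bound is attained by an unsubdivided star
-- all of whose edges have the same labels, the lower one by an unsubdivided star
-- in which min(p, ℓ - 1) edges have distinct labels.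
module Submission where

open import Defs
open import Data.Empty using (⊥)
open import Data.Fin using
  (Fin; zero; suc; toℕ; fromℕ; fromℕ<; inject₁; inject≤; join; splitAt; _↑ˡ_; _↑ʳ_;
   punchIn; punchOut)
open import Data.Fin.Induction using (<-weakInduction)
open import Data.Fin.Properties using
  (_≟_; any?; all?; injective⇒≤; suc-injective; toℕ-injective; toℕ-inject₁; toℕ-fromℕ;
   toℕ-fromℕ<; toℕ<n; ≤fromℕ; inject≤-injective; splitAt-join; splitAt⁻¹-↑ˡ; splitAt⁻¹-↑ʳ;
   punchIn-punchOut; punchInᵢ≢i)
open import Data.Fin.Subset using (Subset; inside; _∈_; ∣_∣)
open import Data.Fin.Subset.Properties using (_∈?_; anySubset?)
import Data.List.Membership.DecPropositional as DecList
import Data.List.Membership.Propositional as List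
open import Data.List.Relation.Unary.All using ([])
open import Data.List.Relation.Unary.All.Properties using (¬Any⇒All¬)
open import Data.List.Relation.Unary.AllPairs using ([]; _∷_)
open import Data.List.Relation.Unary.Any using (here; there)
open import Data.List.Relation.Unary.Unique.Propositional using (Unique)
open import Data.Maybe.Properties using (just-injective)
open import Data.Nat using
  (ℕ; zero; suc; pred; _+_; _*_; _∸_; _⊔_; _≤_; _<_; _≤?_; z≤n; s≤s; s≤s⁻¹; NonZero; >-nonZero)
import Data.Nat as ℕ
open import Data.Nat.Divisibility using (_∣?_; divides)
open import Data.Nat.DivMod using (_%_; [m+kn]%n≡m%n; m<n⇒m%n≡m)
import Data.Nat.Properties as ℕ
open import Data.Product using (Σ-syntax; ∃; ∃-syntax; _×_; _,_; proj₁; proj₂)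
open import Data.Sum using (_⊎_; inj₁; inj₂; [_,_]′)
open import Data.Sum.Properties using (inj₁-injective; inj₂-injective)
open import Data.Unit using (⊤; tt)
open import Data.Vec using (Vec; []; _∷_; lookup; allFin; count; tabulate)
open import Data.Vec.Properties using (lookup-allFin; lookup∘tabulate; lookup⇒[]=; []=⇒lookup)
open import Function using (_∘_; id; case_of_)
open import Function.Bundles using (Equivalence; Inverse; mk⇔; mk↔ₛ′)
open import Function.Definitions using (Injective)
open import Level using (Level; 0ℓ)
open import Relation.Binary.Construct.Closure.Symmetric using (fwd; bwd)
open import Relation.Binary.Core using (Rel)
open import Relation.Binary.Definitions using (tri<; tri≈; tri>)
open import Relation.Binary.PropositionalEquality using
  (_≡_; _≢_; refl; sym; trans; cong; subst; subst₂; ≢-sym; module ≡-Reasoning)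
open import Relation.Nullary using (¬_; Dec; yes; no; does; contradiction)
open import Relation.Nullary.Construct.Add.Supremum using ([_]; ⊤⁺)
open import Relation.Nullary.Decidable using
  (decidable-stable; dec-true; map′; ¬?; _×-dec_; _⊎-dec_; _→-dec_)
open import Relation.Unary using (Pred; Decidable; _≐_)

private
  variable
    a : Level
    A : Set a
    k n : ℕ

-- Counting in finite sets

≡1⇒irrelevant : k ≡ 1 → (i j : Fin k) → i ≡ j
≡1⇒irrelevant refl zero zero = refl

-- Phrased with `pred n` so that it applies to the arms of a star without first writing their number
-- as a successor.
others : (i : Fin n) → Σ[ f ∈ (Fin (pred n) → Fin n) ]
  ((∀ j → j ≢ i → ∃[ c ] f c ≡ j) × (∀ c → f c ≢ i))
others {suc n} i = punchIn i ,
  (λ j j≢i → punchOut (≢-sym j≢i) , punchIn-punchOut (≢-sym j≢i)) ,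
  λ c → punchInᵢ≢i i c

module _ {P : Pred A 0ℓ} (P? : Decidable P) where

  -- With `select`, this makes `count` a cardinality: injections out of and into `Fin (count P? xs)`
  -- become inequalities by the pigeonhole principle.
  rank : (xs : Vec A n) (i : Fin n) → P (lookup xs i) → Fin (count P? xs)
  rank (x ∷ xs) i px with P? x
  rank (x ∷ xs) zero    px | yes _  = zero
  rank (x ∷ xs) (suc i) px | yes _  = suc (rank xs i px)
  rank (x ∷ xs) zero    px | no ¬px = contradiction px ¬px
  rank (x ∷ xs) (suc i) px | no _   = rank xs i px

  rank-injective : (xs : Vec A n) {i j : Fin n} (pi : P (lookup xs i)) (pj : P (lookup xs j)) →
                   rank xs i pi ≡ rank xs j pj → i ≡ j
  rank-injective (x ∷ xs) pi pj eq with P? x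
  rank-injective (x ∷ xs) {zero}  {zero}  pi pj eq | yes _ = refl
  rank-injective (x ∷ xs) {suc i} {suc j} pi pj eq | yes _ =
    cong suc (rank-injective xs pi pj (suc-injective eq))
  rank-injective (x ∷ xs) {zero}  {_}     pi pj eq | no ¬px = contradiction pi ¬px
  rank-injective (x ∷ xs) {suc i} {zero}  pi pj eq | no ¬px = contradiction pj ¬px
  rank-injective (x ∷ xs) {suc i} {suc j} pi pj eq | no _ = cong suc (rank-injective xs pi pj eq)

  select : (xs : Vec A n) → Fin (count P? xs) → Fin n
  select (x ∷ xs) c with P? x
  select (x ∷ xs) zero    | yes _ = zero
  select (x ∷ xs) (suc c) | yes _ = suc (select xs c)
  select (x ∷ xs) c       | no _  = suc (select xs c)

  select-satisfies : (xs : Vec A n) (c : Fin (count P? xs)) → P (lookup xs (select xs c))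
  select-satisfies (x ∷ xs) c with P? x
  select-satisfies (x ∷ xs) zero    | yes px = px
  select-satisfies (x ∷ xs) (suc c) | yes _  = select-satisfies xs c
  select-satisfies (x ∷ xs) c       | no _   = select-satisfies xs c

  select-injective : (xs : Vec A n) → Injective _≡_ _≡_ (select xs)
  select-injective (x ∷ xs) {c} {d} eq with P? x
  select-injective (x ∷ xs) {zero}  {zero}  eq | yes _ = refl
  select-injective (x ∷ xs) {suc c} {suc d} eq | yes _ =
    cong suc (select-injective xs (suc-injective eq))
  select-injective (x ∷ xs) eq | no _ = select-injective xs (suc-injective eq)

  count-≤ : (xs : Vec A n) (f : Fin n → Fin k) →
            (∀ {i j} → P (lookup xs i) → P (lookup xs j) → f i ≡ f j → i ≡ j) →
            count P? xs ≤ k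
  count-≤ xs f inj = injective⇒≤ {f = f ∘ select xs} λ eq →
    select-injective xs (inj (select-satisfies xs _) (select-satisfies xs _) eq)

  count-≥ : (xs : Vec A n) (f : Fin k → Fin n) → Injective _≡_ _≡_ f →
            (∀ i → P (lookup xs (f i))) → k ≤ count P? xs
  count-≥ xs f inj Pf = injective⇒≤ {f = λ i → rank xs (f i) (Pf i)} λ eq →
    inj (rank-injective xs (Pf _) (Pf _) eq)

module _ {P : Pred (Fin n) 0ℓ} (P? : Decidable P) where

  private
    allFin⁺ : ∀ {i} → P i → P (lookup (allFin n) i)
    allFin⁺ = subst P (sym (lookup-allFin _))

    allFin⁻ : ∀ {i} → P (lookup (allFin n) i) → P i
    allFin⁻ = subst P (lookup-allFin _)

  count-allFin-≤ : (f : Fin n → Fin k) → (∀ {i j} → P i → P j → f i ≡ f j → i ≡ j) →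
                   count P? (allFin n) ≤ k
  count-allFin-≤ f inj = count-≤ P? (allFin n) f λ pi pj → inj (allFin⁻ pi) (allFin⁻ pj)

  count-allFin-≥ : (f : Fin k → Fin n) → Injective _≡_ _≡_ f → (∀ i → P (f i)) →
                   k ≤ count P? (allFin n)
  count-allFin-≥ f inj Pf = count-≥ P? (allFin n) f inj (allFin⁺ ∘ Pf)

  count≡1⇒unique : count P? (allFin n) ≡ 1 → ∀ {i j} → P i → P j → i ≡ j
  count≡1⇒unique eq pi pj = rank-injective P? (allFin n) (allFin⁺ pi) (allFin⁺ pj)
    (≡1⇒irrelevant eq _ _)
  unique⇒count≡1 : ∀ {i} → P i → (∀ {j} → P j → j ≡ i) → count P? (allFin n) ≡ 1
  unique⇒count≡1 {i} pi unique = ℕ.≤-antisym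
    (count-allFin-≤ {k = 1} (λ _ → zero) (λ pj pj′ _ → trans (unique pj) (sym (unique pj′))))
    (count-allFin-≥ {k = 1} (λ _ → i) (λ { {zero} {zero} _ → refl }) (λ _ → pi))

∈-rank : (R : Subset n) {v : Fin n} → v ∈ R → Fin ∣ R ∣
∈-rank R {v} v∈R = rank _ R v ([]=⇒lookup v∈R)

∈-rank-injective : (R : Subset n) {u v : Fin n} (u∈R : u ∈ R) (v∈R : v ∈ R) →
                   ∈-rank R u∈R ≡ ∈-rank R v∈R → u ≡ v
∈-rank-injective R u∈R v∈R = rank-injective _ R ([]=⇒lookup u∈R) ([]=⇒lookup v∈R)

image : (Fin k → Fin n) → Subset n
image f = tabulate λ v → does (any? λ i → f i ≟ v)

∈-image : (f : Fin k → Fin n) (i : Fin k) → f i ∈ image f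
∈-image f i = lookup⇒[]= (f i) (image f)
  (trans (lookup∘tabulate _ (f i)) (dec-true (any? λ j → f j ≟ f i) (i , refl)))

-- A choice of preimages is injective, because `f` recovers each member from its preimage.
∣image∣≤ : (f : Fin k → Fin n) → ∣ image f ∣ ≤ k
∣image∣≤ {k} {n} f = injective⇒≤ {f = proj₁ ∘ preimage ∘ member} λ {c} {d} eq →
  select-injective _ (image f)
    (trans (sym (proj₂ (preimage (member c)))) (trans (cong f eq) (proj₂ (preimage (member d)))))
  where
  preimage : ∀ {v} → lookup (image f) v ≡ inside → ∃[ i ] f i ≡ v
  preimage {v} eq
    -- The equation is abstracted together with the decision, so that a negative answer makes it
    -- absurd.
    with any? (λ i → f i ≟ v)
       | trans (sym (lookup∘tabulate (λ v → does (any? λ i → f i ≟ v)) v)) eq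
  ... | yes found | _ = found
  member : (c : Fin ∣ image f ∣) → lookup (image f) (select _ (image f) c) ≡ inside
  member = select-satisfies _ (image f)

-- The known witness bounds the search, which shifts the predicate by one after each failure.
least : {P : Pred ℕ 0ℓ} → Decidable P → ∃ P → ∃[ m ] (P m × (∀ k → P k → m ≤ k))
least P? (n , pn) = search P? n pn
  where
  search : {P : Pred ℕ 0ℓ} → Decidable P → ∀ n → P n → ∃[ m ] (P m × (∀ k → P k → m ≤ k))
  search P? n pn with P? 0
  search P? n       pn | yes p0 = 0 , p0 , λ _ _ → z≤n
  search P? zero    pn | no ¬p0 = contradiction pn ¬p0
  search P? (suc n) pn | no ¬p0 with search (P? ∘ suc) n pn
  ... | m , pm , minimal = suc m , pm ,
    λ { zero p0 → contradiction p0 ¬p0 ; (suc k) pk → s≤s (minimal k pk) }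

-- Timed walks and journeys

module Walks {G : Graph} (Λ : Labelling G) where
  open Graph G
  open Labelling Λ
  open Temporal Λ

  -- Both label sets agree with that of the reversed edge.
  label-irrelevant : ∀ {u v} (e e′ : u ~ v) {t} → label e t → label e′ t
  label-irrelevant e e′ =
    proj₂ (label-sym e′ (~-sym e)) ∘ proj₁ (label-sym e (~-sym e))

  private
    cut : ∀ {u v w t} (W : TimedWalk u w t) → Unique (visited W) → v List.∈ visited W →
          ∃[ t′ ] (t′ ≤ t × Journey u v t′)
    cut stay uq (here refl) = 0 , z≤n , stay , uq
    cut W@(step _ _ _ _) uq (here refl) = _ , ℕ.≤-refl , W , uq
    cut (step W _ _ t<t′) (_ ∷ uq) (there v∈W) =
      let t″ , t″≤t , J = cut W uq v∈W in t″ , ℕ.<⇒≤ (ℕ.≤-<-trans t″≤t t<t′) , J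

  -- Induction on the walk: if its last vertex is new, the step prolongs the journey; otherwise the
  -- prefix up to the earlier visit arrives no later. So distances can be computed with walks.
  walk⇒journey : ∀ {u v t} → TimedWalk u v t → ∃[ t′ ] (t′ ≤ t × Journey u v t′)
  walk⇒journey stay = 0 , z≤n , stay , [] ∷ []
  walk⇒journey {v = v} (step W e l t<t′) with walk⇒journey W
  ... | t₀ , t₀≤t , J , uq with DecList._∈?_ _≟_ v (visited J)
  ...   | yes v∈J = let t₁ , t₁≤t₀ , J′ = cut J uq v∈J in
                    t₁ , ℕ.≤-trans t₁≤t₀ (ℕ.<⇒≤ (ℕ.≤-<-trans t₀≤t t<t′)) , J′
  ...   | no v∉J = _ , ℕ.≤-refl , step J e l (ℕ.≤-<-trans t₀≤t t<t′) , ¬Any⇒All¬ _ v∉J ∷ uq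

  record Crossing (P : Pred Vertex 0ℓ) (s : Vertex) (t : ℕ) : Set where
    field
      {source target} : Vertex
      {departure}     : ℕ
      {crossingTime}  : ℕ
      walk            : TimedWalk s source departure
      edge            : source ~ target
      source∉         : ¬ P source
      target∈         : P target
      label-edge      : label edge crossingTime
      departure<      : departure < crossingTime
      crossingTime≤   : crossingTime ≤ t

  -- Going back from the end, the first vertex found outside `P` marks the last entry into `P`.
  crossing : {P : Pred Vertex 0ℓ} → Decidable P → ∀ {s v t} →
             ¬ P s → P v → TimedWalk s v t → Crossing P s t
  crossing P? ¬Ps Pv stay = contradiction Pv ¬Ps
  crossing P? ¬Ps Pv (step {w = w} W e l t<t′) with P? w
  ... | no ¬Pw = record
    { walk = W ; edge = e ; source∉ = ¬Pw ; target∈ = Pv ; label-edge = l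
    ; departure< = t<t′ ; crossingTime≤ = ℕ.≤-refl }
  ... | yes Pw = record
    { Crossing c hiding (crossingTime≤)
    ; crossingTime≤ = ℕ.≤-trans (Crossing.crossingTime≤ c) (ℕ.<⇒≤ t<t′) }
    where c = crossing P? ¬Ps Pw W

-- Temporal distance when all vertices are connected by timed walks

module Distance {G : Graph} (Λ : Labelling G)
  (label? : ∀ {u v} (e : Graph._~_ G u v) → Decidable (Labelling.label Λ e))
  (connected : ∀ u v → ∃ (Temporal.TimedWalk Λ u v)) where
  open Graph G
  open Labelling Λ
  open Temporal Λ
  open Walks Λ

  private
    Before : ℕ → Vertex → Pred Vertex 0ℓ
    Before n u v = ∃[ t ] (t < n × TimedWalk u v t)

    arrival? : ∀ {n u} → Decidable (Before n u) → ∀ w v →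
               Dec (Σ[ e ∈ w ~ v ] (label e n × Before n u w))
    arrival? {n} before? w v with w ~? v
    ... | no w≁v = no (w≁v ∘ proj₁)
    -- Testing the one proof of adjacency at hand settles all of them, as labels do not depend on
    -- the proof.
    ... | yes e  = map′ (λ (l , b) → e , l , b) (λ (e′ , l , b) → label-irrelevant e′ e l , b)
                        (label? e n ×-dec before? w)

    -- The last step of a walk arriving at `n` prolongs a walk that arrived before `n`, so
    -- decidability follows by course-of-values recursion on time.
    walkAt? : ∀ n u → Decidable (Before n u) → ∀ v → Dec (TimedWalk u v n)
    walkAt? n u before? v = map′ to from
      (((u ≟ v) ×-dec (n ℕ.≟ 0)) ⊎-dec any? λ w → arrival? before? w v)
      where
      to : (u ≡ v × n ≡ 0) ⊎ (∃[ w ] Σ[ e ∈ w ~ v ] (label e n × Before n u w)) → TimedWalk u v n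
      to (inj₁ (refl , refl)) = stay
      to (inj₂ (w , e , l , t , t<n , W)) = step W e l t<n
      from : TimedWalk u v n → (u ≡ v × n ≡ 0) ⊎ (∃[ w ] Σ[ e ∈ w ~ v ] (label e n × Before n u w))
      from stay = inj₁ (refl , refl)
      from (step W e l t<n) = inj₂ (_ , e , l , _ , t<n , W)

    before? : ∀ n u → Decidable (Before n u)
    before? zero    u v = no λ ()
    before? (suc n) u v = map′ to from (before? n u v ⊎-dec walkAt? n u (before? n u) v)
      where
      to : Before n u v ⊎ TimedWalk u v n → Before (suc n) u v
      to (inj₁ (t , t<n , W)) = t , ℕ.m<n⇒m<1+n t<n , W
      to (inj₂ W) = n , ℕ.≤-refl , W
      from : Before (suc n) u v → Before n u v ⊎ TimedWalk u v n
      from (t , t<1+n , W) with ℕ.m<1+n⇒m<n∨m≡n t<1+n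
      ... | inj₁ t<n  = inj₁ (t , t<n , W)
      ... | inj₂ refl = inj₂ W

  walk? : ∀ u v → Decidable (TimedWalk u v)
  walk? u v n = walkAt? n u (before? n u) v

  private
    shortest : ∀ u v → ∃[ d ] (TimedWalk u v d × (∀ t → TimedWalk u v t → d ≤ t))
    shortest u v = least (walk? u v) (connected u v)

  opaque
    -- The least time of a walk rather than of a journey; `dist-journey` shows that the two agree.
    dist : Vertex → Vertex → ℕ
    dist u v = proj₁ (shortest u v)

    dist-walk : ∀ u v → TimedWalk u v (dist u v)
    dist-walk u v = proj₁ (proj₂ (shortest u v))

    dist-≤ : ∀ {u v t} → TimedWalk u v t → dist u v ≤ t
    dist-≤ {u} {v} = proj₂ (proj₂ (shortest u v)) _

  dist-refl : ∀ u → dist u u ≡ 0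
  dist-refl u = ℕ.n≤0⇒n≡0 (dist-≤ {u} stay)

  -- Every step arrives at a positive time, so only the empty walk has time 0.
  dist≡0⇒≡ : ∀ {u v} → dist u v ≡ 0 → u ≡ v
  dist≡0⇒≡ {u} {v} d≡0 with stay ← subst (TimedWalk u v) d≡0 (dist-walk u v) = refl

  dist-journey : ∀ u v → Journey u v (dist u v)
  dist-journey u v with walk⇒journey (dist-walk u v)
  ... | t , t≤d , J@(W , _) = subst (Journey u v) (ℕ.≤-antisym t≤d (dist-≤ W)) J

  dist-isDist : ∀ u v → IsDist u v [ dist u v ]
  dist-isDist u v = dist-journey u v , λ _ (W , _) → dist-≤ W

  -- Links the relational distance to `dist`; the value ∞ is excluded by connectedness.
  isDist⇒≡ : ∀ {u v d} → IsDist u v d → d ≡ [ dist u v ]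
  isDist⇒≡ {u} {v} {[ t ]} ((W , _) , minimal) =
    cong [_] (ℕ.≤-antisym (minimal _ (dist-journey u v)) (dist-≤ W))
  isDist⇒≡ {u} {v} {⊤⁺} unreachable = contradiction (dist-journey u v) (unreachable _)

  resolves⇒≢ : ∀ {s u v} → Resolves s u v → dist s u ≢ dist s v
  resolves⇒≢ (d , d′ , isD , isD′ , d≢d′) eq =
    d≢d′ (trans (isDist⇒≡ isD) (trans (cong [_] eq) (sym (isDist⇒≡ isD′))))

  ≢⇒resolves : ∀ {s u v} → dist s u ≢ dist s v → Resolves s u v
  ≢⇒resolves {s} {u} {v} d≢d′ =
    _ , _ , dist-isDist s u , dist-isDist s v , d≢d′ ∘ just-injective

  isResolvingSet? : Decidable IsResolvingSet
  isResolvingSet? R = map′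
    (λ (reaches , resolves) → record { reaches = reaches ; resolves = resolves })
    (λ r → IsResolvingSet.reaches r , IsResolvingSet.resolves r)
    (all? (λ v → any? λ s → (s ∈? R) ×-dec yes (_ , dist-journey s v))
     ×-dec
     all? (λ u → all? λ v → ¬? (u ≟ v) →-dec any? λ s → (s ∈? R) ×-dec
       map′ ≢⇒resolves resolves⇒≢ (¬? (dist s u ℕ.≟ dist s v))))

  opaque
    -- Being a resolving set is decidable and there are finitely many subsets, so the attained sizes
    -- form a decidable set of numbers, whose least element is found constructively.
    resolving⇒isM : ∀ {R} → IsResolvingSet R → ∃[ m ] (IsM m × m ≤ ∣ R ∣)
    resolving⇒isM {R} resolving =
      let m , isMin , minimal = least size? (_ , R , resolving , refl)
      in m , (isMin , λ R′ r → minimal _ (R′ , r , refl)) , minimal _ (R , resolving , refl)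
      where
      size? : Decidable λ k → ∃[ R ] (IsResolvingSet R × ∣ R ∣ ≡ k)
      size? k = anySubset? λ R → isResolvingSet? R ×-dec (∣ R ∣ ℕ.≟ k)

  -- By connectedness a single member already reaches every vertex.
  isResolvingSet : ∀ {R} → ∃[ s ] s ∈ R →
                   (∀ u v → u ≢ v → ∃[ s ] (s ∈ R × dist s u ≢ dist s v)) → IsResolvingSet R
  isResolvingSet (s , s∈R) separates = record
    { reaches  = λ v → s , s∈R , _ , dist-journey s v
    ; resolves = λ u v u≢v → let s , s∈R , d≢d′ = separates u v u≢v in s , s∈R , ≢⇒resolves d≢d′
    }

  -- A shortest walk to `v` must cross into `P`; it is at `u` just before, and the crossing takes a
  -- strictly later time-step.
  gate-< : {P : Pred Vertex 0ℓ} → Decidable P → ∀ {s u v} →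
           (∀ {x y} → x ~ y → ¬ P x → P y → x ≡ u) → ¬ P s → P v → dist s u < dist s v
  gate-< P? {s} {u} {v} gate ¬Ps Pv = ℕ.≤-<-trans
    (dist-≤ (subst (λ x → TimedWalk s x departure) (gate edge source∉ target∈) walk))
    (ℕ.<-≤-trans departure< crossingTime≤)
    where open Crossing (crossing P? ¬Ps Pv (dist-walk s v))

-- Periodic labels

module Periodic {G : Graph} (Λ : Labelling G) {p : ℕ} (1≤p : 1 ≤ p)
                (periodic : IsPeriodic1Labelling p Λ) where
  open Graph G
  open Labelling Λ
  open Temporal Λ

  -- Membership in the progression is divisibility of `t ∸ i` by `p`, guarded by `i ≤ t` because
  -- subtraction is truncated.
  label? : ∀ {u v} (e : u ~ v) → Decidable (label e)
  label? e t with i , _ , _ , l⇔ ← periodic e = map′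
    (λ { (i≤t , divides k eq) → proj₂ l⇔ (k , trans (sym (ℕ.m+[n∸m]≡n i≤t)) (cong (i +_) eq)) })
    (λ l → let k , eq = proj₁ l⇔ l in
       subst (i ≤_) (sym eq) (ℕ.m≤m+n i _) ,
       divides k (trans (cong (_∸ i) eq) (ℕ.m+n∸m≡n i _)))
    ((i ≤? t) ×-dec (p ∣? (t ∸ i)))

  later : ∀ {u v} (e : u ~ v) t → ∃[ t′ ] (t < t′ × label e t′)
  later e t with i , 1≤i , _ , l⇔ ← periodic e =
    -- This exceeds `t` because `i` and `p` are both at least 1.
    i + t * p , ℕ.+-mono-≤ 1≤i (ℕ.m≤m*n t p ⦃ >-nonZero 1≤p ⦄) , proj₂ l⇔ (t , refl)

  extend : ∀ {u v w} → ∃ (TimedWalk u w) → w ~ v → ∃ (TimedWalk u v)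
  extend (t , W) e = let t′ , t<t′ , l = later e t in t′ , step W e l t<t′

  private
    predFin : ∀ i → 1 ≤ i → i ≤ p → Fin p
    predFin (suc i) _ i<p = fromℕ< i<p

    predFin-injective : ∀ i j {1≤i 1≤j i≤p j≤p} → predFin i 1≤i i≤p ≡ predFin j 1≤j j≤p → i ≡ j
    predFin-injective (suc i) (suc j) eq =
      cong suc (trans (sym (toℕ-fromℕ< _)) (trans (cong toℕ eq) (toℕ-fromℕ< _)))

  -- The first time-step of the edge, shifted from the range 1 to `p` down to 0 to `p - 1`.
  offset : ∀ {u v} → u ~ v → Fin p
  offset e = let i , 1≤i , i≤p , _ = periodic e in predFin i 1≤i i≤p

  offset⇒label : ∀ {u v u′ v′} (e : u ~ v) (e′ : u′ ~ v′) → offset e ≡ offset e′ →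
                 ∀ {t} → label e t → label e′ t
  offset⇒label e e′ eq l with periodic e | periodic e′
  ... | i , _ , _ , l⇔ | i′ , _ , _ , l′⇔
    with refl ← predFin-injective i i′ eq = proj₂ l′⇔ (proj₁ l⇔ l)

-- Arms of a star and their outer segments

module _ {m : ℕ} {σ : Fin m → ℕ} where

  -- One family for the regions cut off by gates: the whole arm at `k = 0`, its outer segments for
  -- larger `k`.
  Beyond : Fin m → ℕ → Pred (StarVertex σ) 0ℓ
  Beyond i k centre    = ⊥
  Beyond i k (on i′ j) = i ≡ i′ × k ≤ toℕ j

  Beyond? : ∀ i k → Decidable (Beyond i k)
  Beyond? i k centre    = no id
  Beyond? i k (on i′ j) = (i ≟ i′) ×-dec (k ≤? toℕ j)

  Beyond-weaken : ∀ {i k} x → Beyond i k x → Beyond i 0 x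
  Beyond-weaken (on _ _) (i≡ , _) = i≡ , z≤n

  Beyond-zero-unique : ∀ {i j} x → Beyond i 0 x → Beyond j 0 x → i ≡ j
  Beyond-zero-unique (on _ _) (refl , _) (refl , _) = refl

  -- Only an inward link can leave an outer segment, and it does so from the innermost vertex.
  leave-beyond : ∀ {i j x y} → StarAdjacent σ x y →
                 Beyond i (toℕ j) x → ¬ Beyond i (toℕ j) y → x ≡ on i j
  leave-beyond (fwd (next i j)) (refl , k≤) ¬y =
    contradiction (refl , ℕ.m≤n⇒m≤1+n (subst (_ ≤_) (toℕ-inject₁ j) k≤)) ¬y
  leave-beyond (bwd (spoke i)) (refl , k≤0) ¬y =
    cong (on i) (toℕ-injective (sym (ℕ.n≤0⇒n≡0 k≤0)))
  leave-beyond (bwd (next i j)) (refl , k≤) ¬y = cong (on i) (toℕ-injective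
    (ℕ.≤-antisym (ℕ.≰⇒> λ k≤j → ¬y (refl , subst (_ ≤_) (sym (toℕ-inject₁ j)) k≤j)) k≤))

  enter-arm : ∀ {i x y} → StarAdjacent σ x y →
              ¬ Beyond i 0 x → Beyond i 0 y → x ≡ centre × y ≡ on i zero
  enter-arm (fwd (spoke i))  ¬x (refl , _) = refl , refl
  enter-arm (fwd (next i j)) ¬x (refl , _) = contradiction (refl , z≤n) ¬x
  enter-arm (bwd (next i j)) ¬x (refl , _) = contradiction (refl , z≤n) ¬x

  -- The threshold is a successor, so the segment is entered from a vertex of the arm and never from
  -- the centre.
  enter-beyond : ∀ {i j x y} → StarAdjacent σ x y →
                 ¬ Beyond i (suc (toℕ j)) x → Beyond i (suc (toℕ j)) y → x ≡ on i j
  enter-beyond (fwd (next i j)) ¬x (refl , k<) = cong (on i) (toℕ-injective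
    (ℕ.≤-antisym (ℕ.≮⇒≥ λ k<x → ¬x (refl , k<x))
                 (subst (_ ≤_) (sym (toℕ-inject₁ j)) (s≤s⁻¹ k<))))
  enter-beyond (bwd (next i j)) ¬x (refl , k<) =
    contradiction (refl , ℕ.m≤n⇒m≤1+n (subst (_ <_) (toℕ-inject₁ j) k<)) ¬x

  on-injective : ∀ {i i′ j j′} → on {s = σ} i j ≡ on i′ j′ → i ≡ i′
  on-injective refl = refl

  tip : Fin m → StarVertex σ
  tip i = on i (fromℕ (σ i))

  parent : StarVertex σ → StarVertex σ
  parent centre         = centre
  parent (on i zero)    = centre
  parent (on i (suc j)) = on i (inject₁ j)

  parent-link : ∀ i j → StarLink σ (parent (on i j)) (on i j)
  parent-link i zero    = spoke i
  parent-link i (suc j) = next i j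

  link⇒parent : ∀ {x y} → StarLink σ x y → x ≡ parent y
  link⇒parent (spoke i)  = refl
  link⇒parent (next i j) = refl

  IsTip : Pred (StarVertex σ) 0ℓ
  IsTip centre   = ⊥
  IsTip (on i j) = toℕ j ≡ σ i

  link⇒¬tip : ∀ {x y} → StarLink σ x y → ¬ IsTip x
  link⇒¬tip (next i j) eq = ℕ.<⇒≢ (toℕ<n j) (trans (sym (toℕ-inject₁ j)) eq)

  tip-neighbour : ∀ {x y} → IsTip x → StarAdjacent σ x y → y ≡ parent x
  tip-neighbour tip (fwd x→y) = contradiction tip (link⇒¬tip x→y)
  tip-neighbour tip (bwd y→x) = link⇒parent y→x

  -- Links raise it by one, which keeps the parent of a vertex apart from its child.
  depth : StarVertex σ → ℕ
  depth centre   = 0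
  depth (on i j) = suc (toℕ j)

  link-depth : ∀ {x y} → StarLink σ x y → depth y ≡ suc (depth x)
  link-depth (spoke i)  = refl
  link-depth (next i j) = cong (λ d → suc (suc d)) (sym (toℕ-inject₁ j))

  child : ∀ i j → ¬ IsTip (on i j) → ∃ (StarLink σ (on i j))
  child i j ¬tip with j<σ ← ℕ.≤∧≢⇒< (s≤s⁻¹ (toℕ<n j)) ¬tip =
    -- `next` starts at an `inject₁`, so `j` has to be recognised as one.
    _ , subst (λ j → StarLink σ (on i j) (on i (suc (fromℕ< j<σ))))
      (toℕ-injective (trans (toℕ-inject₁ _) (toℕ-fromℕ< j<σ))) (next i (fromℕ< j<σ))

-- Leaves and arms

module Star {G : Graph} (star : IsSubdividedStar G) where
  open Graph G
  open IsSubdividedStar star public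
  open Inverse vertices public using (to; from)

  from∘to : ∀ x → from (to x) ≡ x
  from∘to = Inverse.strictlyInverseʳ vertices

  to∘from : ∀ v → to (from v) ≡ v
  to∘from = Inverse.strictlyInverseˡ vertices

  to-injective : ∀ {x y} → to x ≡ to y → x ≡ y
  to-injective eq = trans (sym (from∘to _)) (trans (cong from eq) (from∘to _))

  from≡⇒≡to : ∀ {v x} → from v ≡ x → v ≡ to x
  from≡⇒≡to eq = trans (sym (to∘from _)) (cong to eq)

  edge⁺ : ∀ {x y} → StarAdjacent subdivisions x y → to x ~ to y
  edge⁺ = Equivalence.to (adjacency _ _)

  edge⁻ : ∀ {u v} → u ~ v → StarAdjacent subdivisions (from u) (from v)
  edge⁻ e = Equivalence.from (adjacency _ _) (subst₂ _~_ (sym (to∘from _)) (sym (to∘from _)) e)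

  spokeEdge : ∀ i → to centre ~ to (on i zero)
  spokeEdge i = edge⁺ (fwd (spoke i))

  degree≡1⇒unique : ∀ {x y z} → degree (to x) ≡ 1 →
    StarAdjacent subdivisions x y → StarAdjacent subdivisions x z → y ≡ z
  degree≡1⇒unique d≡1 xy xz =
    to-injective (count≡1⇒unique (_ ~?_) d≡1 (edge⁺ xy) (edge⁺ xz))

  degree-tip : ∀ i → degree (to (tip i)) ≡ 1
  degree-tip i = unique⇒count≡1 (to (tip i) ~?_) (edge⁺ (bwd (parent-link i _))) λ {v} e →
    from≡⇒≡to (tip-neighbour {x = tip i} (toℕ-fromℕ _)
      (subst (λ x → StarAdjacent subdivisions x (from v)) (from∘to (tip i)) (edge⁻ e)))

  -- Short of the tip there are two neighbours, parent and child, whose depths differ by two.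
  degree≡1⇒tip : ∀ i j → degree (to (on i j)) ≡ 1 → toℕ j ≡ subdivisions i
  degree≡1⇒tip i j d≡1 = decidable-stable (toℕ j ℕ.≟ _) λ ¬tip →
    let y , x→y = child i j ¬tip
        parent≡y = degree≡1⇒unique d≡1 (bwd (parent-link i j)) (fwd x→y)
    in ℕ.m≢1+m+n _ {n = 1} (trans (trans (cong depth parent≡y)
         (trans (link-depth x→y) (cong suc (link-depth (parent-link i j)))))
         (cong suc (ℕ.+-comm 1 _)))

  private
    -- The extra value `zero` stands for the centre, which is a leaf when there is only one arm.
    arm : StarVertex subdivisions → Fin (suc edges)
    arm centre   = zero
    arm (on i _) = suc i

    leaf-arm-injective : ∀ x y → degree (to x) ≡ 1 → degree (to y) ≡ 1 → arm x ≡ arm y → x ≡ y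
    leaf-arm-injective centre    centre     _  _   _    = refl
    leaf-arm-injective (on i j) (on .i j′) d≡1 d′≡1 refl =
      cong (on i) (toℕ-injective (trans (degree≡1⇒tip i j d≡1) (sym (degree≡1⇒tip i j′ d′≡1))))

    from-injective : ∀ {u v} → from u ≡ from v → u ≡ v
    from-injective eq = trans (from≡⇒≡to eq) (to∘from _)

    leafCount-by : (f : StarVertex subdivisions → Fin k) →
                   (∀ x y → degree (to x) ≡ 1 → degree (to y) ≡ 1 → f x ≡ f y → x ≡ y) →
                   leafCount ≤ k
    leafCount-by f inj = count-allFin-≤ (λ v → degree v ℕ.≟ 1) (f ∘ from) λ du dv eq →
      from-injective (inj _ _ (leaf du) (leaf dv) eq)
      where
      leaf : ∀ {v} → degree v ≡ 1 → degree (to (from v)) ≡ 1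
      leaf = subst (λ v → degree v ≡ 1) (sym (to∘from _))

  leafCount≤1+edges : leafCount ≤ suc edges
  leafCount≤1+edges = leafCount-by arm leaf-arm-injective

  edges≤leafCount : edges ≤ leafCount
  edges≤leafCount = count-allFin-≥ (λ v → degree v ℕ.≟ 1) (to ∘ tip)
    (λ eq → on-injective (to-injective eq)) degree-tip

  -- Two spokes give the centre two neighbours, so every leaf is the tip of an arm.
  leafCount≤edges : 2 ≤ edges → leafCount ≤ edges
  leafCount≤edges 2≤m = leafCount-by f f-injective
    where
    0<m = ℕ.<⇒≤ 2≤m
    centre-degree : degree (to centre) ≢ 1
    centre-degree d≡1 = case trans (sym (toℕ-fromℕ< 0<m)) (trans (cong toℕ
      (on-injective (degree≡1⇒unique d≡1 (fwd (spoke (fromℕ< 0<m))) (fwd (spoke (fromℕ< 2≤m))))))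
      (toℕ-fromℕ< 2≤m)) of λ ()
    f : StarVertex subdivisions → Fin edges
    -- An arbitrary value: the centre is not a leaf, so it never enters the comparison.
    f centre   = fromℕ< 0<m
    f (on i _) = i
    f-injective : ∀ x y → degree (to x) ≡ 1 → degree (to y) ≡ 1 → f x ≡ f y → x ≡ y
    f-injective centre   _        d≡1 _    _  = contradiction d≡1 centre-degree
    f-injective (on _ _) centre   _   d≡1  _  = contradiction d≡1 centre-degree
    f-injective (on i j) (on i′ j′) d≡1 d′≡1 eq =
      leaf-arm-injective (on i j) (on i′ j′) d≡1 d′≡1 (cong suc eq)

  -- Both bounds for an arbitrary periodic labelling

  module Bounds (Λ : Labelling G) {p : ℕ} (1≤p : 1 ≤ p)
                (periodic : IsPeriodic1Labelling p Λ) where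
    open Labelling Λ
    open Temporal Λ
    open Walks Λ
    open Periodic Λ 1≤p periodic

    private
      toCentre : ∀ {u} x → ∃ (TimedWalk u (to x)) → ∃ (TimedWalk u (to centre))
      toCentre centre   W = W
      toCentre {u} (on i j) = <-weakInduction
        (λ j → ∃ (TimedWalk u (to (on i j))) → ∃ (TimedWalk u (to centre)))
        (λ W → extend W (~-sym (spokeEdge i)))
        (λ j toC W → toC (extend W (edge⁺ (bwd (next i j))))) j

      fromCentre : ∀ {u} x → ∃ (TimedWalk u (to centre)) → ∃ (TimedWalk u (to x))
      fromCentre centre   W = W
      fromCentre {u} (on i j) W = <-weakInduction
        (λ j → ∃ (TimedWalk u (to (on i j))))
        (extend W (spokeEdge i))
        (λ j W → extend W (edge⁺ (fwd (next i j)))) j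

    connected : ∀ u v → ∃ (TimedWalk u v)
    connected u v = subst₂ (λ u v → ∃ (TimedWalk u v)) (to∘from u) (to∘from v)
      (fromCentre (from v) (toCentre (from u) (0 , stay)))

    open Distance Λ label? connected public

    star-gate-< : {P : Pred (StarVertex subdivisions) 0ℓ} → Decidable P → ∀ {s x y} →
      (∀ {w z} → StarAdjacent subdivisions w z → ¬ P w → P z → w ≡ x) →
      ¬ P (from s) → P y → dist s (to x) < dist s (to y)
    star-gate-< {P} P? gate ¬Ps Py = gate-< (P? ∘ from)
      (λ e ¬Pu Pv → from≡⇒≡to (gate (edge⁻ e) ¬Pu Pv)) ¬Ps (subst P (sym (from∘to _)) Py)

    centre-<-arm : ∀ {s i j} → ¬ Beyond i 0 (from s) → dist s (to centre) < dist s (to (on i j))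
    centre-<-arm {i = i} ¬s = star-gate-< (Beyond? i 0) (λ wz ¬w z → proj₁ (enter-arm wz ¬w z))
      ¬s (refl , z≤n)

    -- A walk from outside the arm meets its vertices in outward order, so `on i j` is the gate to
    -- the segment after it.
    outward-< : ∀ {s i j j′} → ¬ Beyond i 0 (from s) → toℕ j < toℕ j′ →
                dist s (to (on i j)) < dist s (to (on i j′))
    outward-< {s} {i} {j} ¬s j<j′ = star-gate-< (Beyond? i (suc (toℕ j))) enter-beyond
      (λ b → ¬s (Beyond-weaken (from s) b)) (refl , j<j′)

    -- Seen from the tip, `on i j` is the gate to the complement of the segment that it begins.
    tip-<-outside : ∀ {i j y} → ¬ Beyond i (toℕ j) y →
                    dist (to (tip i)) (to (on i j)) < dist (to (tip i)) (to y)
    tip-<-outside {i} {j} = star-gate-< (¬? ∘ Beyond? i (toℕ j))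
      (λ wz ¬¬w ¬z → leave-beyond wz (decidable-stable (Beyond? i (toℕ j) _) ¬¬w) ¬z)
      (λ ¬s → ¬s (subst (Beyond i (toℕ j)) (sym (from∘to (tip i)))
        (refl , ≤fromℕ j)))

    -- Two vertices, one of which is on an arm other than i₀, are told apart by the
    -- tip of that arm; all other pairs by any member of R outside the arm i₀.
    tips-resolve : ∀ {R} i₀ → (∀ i → i ≢ i₀ → to (tip i) ∈ R) →
                   ∃[ s ] (s ∈ R × ¬ Beyond i₀ 0 (from s)) → IsResolvingSet R
    tips-resolve {R} i₀ tip∈R (s , s∈R , ¬s) = isResolvingSet (s , s∈R) λ u v u≢v →
      subst₂ (λ u v → ∃[ s ] (s ∈ R × dist s u ≢ dist s v)) (to∘from u) (to∘from v)
        (separate (from u) (from v) λ eq → u≢v (trans (from≡⇒≡to eq) (to∘from v)))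
      where
      Separated : Rel (StarVertex subdivisions) 0ℓ
      Separated x y = ∃[ s ] (s ∈ R × dist s (to x) ≢ dist s (to y))

      flip : ∀ {x y} → Separated x y → Separated y x
      flip (s , s∈R , d≢d′) = s , s∈R , ≢-sym d≢d′

      by-tip : ∀ {i} → i ≢ i₀ → ∀ j y → on i j ≢ y → Separated (on i j) y
      by-tip {i} i≢i₀ j y ≢y with Beyond? i (toℕ j) y
      ... | no ¬y = _ , tip∈R i i≢i₀ , ℕ.<⇒≢ (tip-<-outside ¬y)
      -- The second vertex is further out on the same arm, so the tip reaches it first and the roles
      -- are exchanged.
      by-tip {i} i≢i₀ j (on i j′) ≢y | yes (refl , j≤j′) =
        _ , tip∈R i i≢i₀ , ≢-sym (ℕ.<⇒≢ (tip-<-outside λ (_ , j′≤j) →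
          ≢y (cong (on i) (toℕ-injective (ℕ.≤-antisym j≤j′ j′≤j)))))

      separate : ∀ x y → x ≢ y → Separated x y
      separate centre centre x≢y = contradiction refl x≢y
      separate centre (on i j) x≢y with i ≟ i₀
      ... | no i≢i₀  = flip (by-tip i≢i₀ j centre (≢-sym x≢y))
      ... | yes refl = s , s∈R , ℕ.<⇒≢ (centre-<-arm ¬s)
      separate (on i j) centre x≢y = flip (separate centre (on i j) (≢-sym x≢y))
      separate (on i j) (on i′ j′) x≢y with i ≟ i₀ | i′ ≟ i₀
      ... | no i≢i₀ | _         = by-tip i≢i₀ j _ x≢y
      ... | yes _   | no i′≢i₀  = flip (by-tip i′≢i₀ j′ _ (≢-sym x≢y))
      ... | yes refl | yes refl with ℕ.<-cmp (toℕ j) (toℕ j′)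
      ...   | tri< j<j′ _ _ = s , s∈R , ℕ.<⇒≢ (outward-< ¬s j<j′)
      ...   | tri≈ _ j≡j′ _ = contradiction (cong (on i) (toℕ-injective j≡j′)) x≢y
      ...   | tri> _ _ j′<j = s , s∈R , ≢-sym (ℕ.<⇒≢ (outward-< ¬s j′<j))

    -- A walk into an arm uses its spoke, after which the spoke of any other arm
    -- with the same labels could have been taken instead.
    equal-spokes : ∀ {s i j} → ¬ Beyond i 0 (from s) →
                   (∀ {t} → label (spokeEdge i) t → label (spokeEdge j) t) →
                   dist s (to (on j zero)) ≤ dist s (to (on i zero))
    equal-spokes {s} {i} {j} ¬s i⇒j =
      ℕ.≤-trans (via-spoke walk edge label-edge departure< (from≡⇒≡to (proj₁ ends))
                  (from≡⇒≡to (proj₂ ends)))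
                crossingTime≤
      where
      open Crossing (crossing (Beyond? i 0 ∘ from) ¬s
        (subst (Beyond i 0) (sym (from∘to (on i zero))) (refl , z≤n))
        (dist-walk s (to (on i zero))))
      ends = enter-arm (edge⁻ edge) source∉ target∈
      -- The ends of the edge are variables here, so that their equations can be matched with
      -- `refl`.
      via-spoke : ∀ {w v t t′} → TimedWalk s w t → (e : w ~ v) → label e t′ → t < t′ →
                  w ≡ to centre → v ≡ to (on i zero) → dist s (to (on j zero)) ≤ t′
      via-spoke W e l t<t′ refl refl =
        dist-≤ (step W (spokeEdge j) (i⇒j (label-irrelevant e (spokeEdge i) l)) t<t′)

    -- An arm is coded by a member of `R` on it or, failing that, by its class, and this code is
    -- injective. The number `q` of classes is left open: the lower bound takes `q = p`, tightness
    -- of the upper bound takes `q = 1`.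
    edges≤∣R∣+classes : ∀ {q R} (class : Fin edges → Fin q) →
      (∀ i j → class i ≡ class j → ∀ {t} → label (spokeEdge i) t → label (spokeEdge j) t) →
      IsResolvingSet R → edges ≤ ∣ R ∣ + q
    edges≤∣R∣+classes {q} {R} class class⇒label resolving =
      injective⇒≤ {f = join ∣ R ∣ q ∘ proj₁ ∘ code} λ {i} {j} eq →
        code-injective (code i) (code j)
          (trans (sym (splitAt-join ∣ R ∣ q _))
            (trans (cong (splitAt ∣ R ∣) eq) (splitAt-join ∣ R ∣ q _)))
      where
      Occupied : Fin edges → Set
      Occupied i = ∃[ v ] (v ∈ R × Beyond i 0 (from v))

      -- A relation, so that matching on a code recovers the member of `R` or the proof that there
      -- is none.
      data Code (i : Fin edges) : Fin ∣ R ∣ ⊎ Fin q → Set where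
        occupied : ∀ {v} (v∈R : v ∈ R) → Beyond i 0 (from v) → Code i (inj₁ (∈-rank R v∈R))
        free     : ¬ Occupied i → Code i (inj₂ (class i))

      code : ∀ i → ∃ (Code i)
      code i with any? (λ v → (v ∈? R) ×-dec Beyond? i 0 (from v))
      ... | yes (v , v∈R , b) = _ , occupied v∈R b
      ... | no ¬occupied      = _ , free ¬occupied

      code-injective : ∀ {i j} (c : ∃ (Code i)) (d : ∃ (Code j)) → proj₁ c ≡ proj₁ d → i ≡ j
      code-injective (_ , occupied u∈R bu) (_ , occupied v∈R bv) eq
        with refl ← ∈-rank-injective R u∈R v∈R (inj₁-injective eq) = Beyond-zero-unique _ bu bv
      code-injective {i} {j} (_ , free ¬i) (_ , free ¬j) eq = decidable-stable (i ≟ j) λ i≢j →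
        let same = inj₂-injective eq
            s , s∈R , resolved = IsResolvingSet.resolves resolving (to (on i zero)) (to (on j zero))
              λ eq′ → i≢j (on-injective (to-injective eq′))
        -- Neither arm contains `s`, so `equal-spokes` applies in both directions.
        in resolves⇒≢ resolved (ℕ.≤-antisym
             (equal-spokes (λ b → ¬j (s , s∈R , b)) (class⇒label j i (sym same)))
             (equal-spokes (λ b → ¬i (s , s∈R , b)) (class⇒label i j same)))

    resolving⇒nonempty : ∀ {R} → IsResolvingSet R → 1 ≤ ∣ R ∣
    resolving⇒nonempty {R} resolving
      with s , s∈R , _ ← IsResolvingSet.reaches resolving (to centre)
      with ∣ R ∣ | ∈-rank R s∈R
    ... | suc _ | _ = s≤s z≤n

    resolvingSet : 2 ≤ leafCount → ∃[ R ] (IsResolvingSet R × ∣ R ∣ ≤ leafCount ∸ 1)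
    resolvingSet 2≤ℓ with 2 ≤? edges
    ... | yes 2≤m with f , onto , avoids ← others (fromℕ< 2≤m) =
      image (to ∘ tip ∘ f) ,
      tips-resolve (fromℕ< 2≤m)
        (λ i i≢i₀ → let c , fc≡i = onto i i≢i₀ in
          subst (λ i → to (tip i) ∈ image (to ∘ tip ∘ f)) fc≡i (∈-image (to ∘ tip ∘ f) c))
        -- With two arms or more, at least one tip remains, and it lies outside the omitted arm.
        (let c = fromℕ< (ℕ.pred-mono-≤ 2≤m) in
          _ , ∈-image (to ∘ tip ∘ f) c , λ b → avoids c
            (sym (proj₁ (subst (Beyond (fromℕ< 2≤m) 0) (from∘to (tip (f c))) b)))) ,
      ℕ.≤-trans (∣image∣≤ (to ∘ tip ∘ f)) (ℕ.pred-mono-≤ edges≤leafCount)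
    -- With a single arm the star is a path with the centre as an end; no other arm needs its tip,
    -- and the centre lies outside the arm.
    ... | no 2≰m =
      image centre₁ ,
      tips-resolve (fromℕ< 1≤m)
        (λ i i≢i₀ → contradiction (≡1⇒irrelevant (ℕ.≤-antisym (ℕ.≮⇒≥ 2≰m) 1≤m) _ _) i≢i₀)
        (_ , ∈-image centre₁ zero , subst (Beyond (fromℕ< 1≤m) 0) (from∘to centre)) ,
      ℕ.≤-trans (∣image∣≤ centre₁) (ℕ.pred-mono-≤ 2≤ℓ)
      where
      1≤m : 1 ≤ edges
      1≤m = s≤s⁻¹ (ℕ.≤-trans 2≤ℓ leafCount≤1+edges)
      centre₁ : Fin 1 → Vertex
      centre₁ _ = to centre

    lowerBound : ∀ {R} → IsResolvingSet R → 1 ⊔ (leafCount ∸ p) ≤ ∣ R ∣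
    lowerBound {R} resolving =
      ℕ.⊔-lub (resolving⇒nonempty resolving) (ℕ.m≤n+o⇒m∸n≤o leafCount p ℓ≤p+∣R∣)
      where
      ℓ≤p+∣R∣ : leafCount ≤ p + ∣ R ∣
      ℓ≤p+∣R∣ with 2 ≤? edges
      ... | yes 2≤m = ℕ.≤-trans (leafCount≤edges 2≤m) (subst (edges ≤_) (ℕ.+-comm ∣ R ∣ p)
              (edges≤∣R∣+classes (offset ∘ spokeEdge)
                (λ i j → offset⇒label (spokeEdge i) (spokeEdge j)) resolving))
      -- At most two leaves, covered by `1 ≤ p` and `1 ≤ ∣ R ∣`.
      ... | no 2≰m = ℕ.≤-trans leafCount≤1+edges (ℕ.≤-trans (s≤s (ℕ.≮⇒≥ 2≰m))
              (ℕ.+-mono-≤ 1≤p (resolving⇒nonempty resolving)))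

    opaque
      bounds : 2 ≤ leafCount → ∃[ m ] (IsM m × 1 ⊔ (leafCount ∸ p) ≤ m × m ≤ leafCount ∸ 1)
      bounds 2≤ℓ =
        let _ , resolving , R≤                     = resolvingSet 2≤ℓ
            m , isM@((_ , resolvingₘ , ≡m) , _) , m≤R = resolving⇒isM resolving
        in m , isM , subst (1 ⊔ (leafCount ∸ p) ≤_) ≡m (lowerBound resolvingₘ) , ℕ.≤-trans m≤R R≤

-- Extremal examples: unsubdivided stars with prescribed labels

module PlainStar (m : ℕ) {p : ℕ} (1≤p : 1 ≤ p) (class : Fin m → Fin p) where

  Spoke : Rel (Fin (suc m)) 0ℓ
  Spoke zero    zero    = ⊥
  Spoke zero    (suc _) = ⊤
  Spoke (suc _) zero    = ⊤
  Spoke (suc _) (suc _) = ⊥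

  graph : Graph
  graph = record
    { order    = suc m
    ; _~_      = Spoke
    ; _~?_     = λ { zero zero → no id ; zero (suc _) → yes tt
                   ; (suc _) zero → yes tt ; (suc _) (suc _) → no id }
    ; ~-sym    = λ { {zero} {suc _} _ → tt ; {suc _} {zero} _ → tt }
    ; ~-irrefl = λ { {zero} refl () ; {suc _} refl () }
    }

  isStar : IsSubdividedStar graph
  isStar = record
    { edges        = m
    ; subdivisions = λ _ → 0
    ; vertices     = mk↔ₛ′
        (λ { centre → zero ; (on i zero) → suc i })
        (λ { zero → centre ; (suc i) → on i zero })
        (λ { zero → refl ; (suc i) → refl })
        (λ { centre → refl ; (on i zero) → refl })
    ; adjacency    = λ
        { centre centre → mk⇔ (λ { (fwd ()) ; (bwd ()) }) λ ()
        ; centre (on i zero) → mk⇔ (λ _ → tt) (λ _ → fwd (spoke i))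
        ; (on i zero) centre → mk⇔ (λ _ → tt) (λ _ → bwd (spoke i))
        ; (on i zero) (on j zero) → mk⇔ (λ { (fwd ()) ; (bwd ()) }) λ ()
        }
    }

  times : Fin m → Pred ℕ 0ℓ
  times i t = ∃[ k ] t ≡ suc (toℕ (class i)) + k * p

  -- The class is the residue of `t - 1` modulo `p`, since time-steps count from 1 and classes from
  -- 0.
  times-disjoint : ∀ {i j t} → times i t → times j t → class i ≡ class j
  times-disjoint {i} {j} (k , t≡) (k′ , t≡′) = toℕ-injective (begin
    toℕ (class i)                ≡⟨ residue (class i) k ⟨
    (toℕ (class i) + k * p) % p  ≡⟨ cong (_% p) (ℕ.suc-injective (trans (sym t≡) t≡′)) ⟩
    (toℕ (class j) + k′ * p) % p ≡⟨ residue (class j) k′ ⟩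
    toℕ (class j)                ∎)
    where
    open ≡-Reasoning
    instance
      p≢0 : NonZero p
      p≢0 = >-nonZero 1≤p
    residue : ∀ (c : Fin p) k → (toℕ c + k * p) % p ≡ toℕ c
    residue c k = trans ([m+kn]%n≡m%n (toℕ c) k p) (m<n⇒m%n≡m (toℕ<n c))

  labelling : Labelling graph
  labelling = record
    { label     = λ {u} {v} → label {u} {v}
    ; label-sym = λ {u} {v} → label-sym {u} {v}
    }
    where
    label : ∀ {u v} → Spoke u v → Pred ℕ 0ℓ
    label {zero}  {suc i} _ = times i
    label {suc i} {zero}  _ = times i
    label-sym : ∀ {u v} (e : Spoke u v) (e′ : Spoke v u) → label {u} {v} e ≐ label {v} {u} e′
    label-sym {zero}  {suc i} _ _ = id , id
    label-sym {suc i} {zero}  _ _ = id , id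

  periodic : IsPeriodic1Labelling p labelling
  periodic {zero}  {suc i} _ = suc (toℕ (class i)) , s≤s z≤n , toℕ<n (class i) , id , id
  periodic {suc i} {zero}  _ = suc (toℕ (class i)) , s≤s z≤n , toℕ<n (class i) , id , id

  open Temporal labelling
  open Star isStar using (edges≤leafCount; leafCount≤edges; module Bounds)
  open Bounds labelling 1≤p periodic public

  leafCount≡m : 2 ≤ m → Graph.leafCount graph ≡ m
  leafCount≡m 2≤m = ℕ.≤-antisym (leafCount≤edges 2≤m) edges≤leafCount

  bounds-m : 2 ≤ m → ∃[ k ] (IsM k × 1 ⊔ (m ∸ p) ≤ k × k ≤ m ∸ 1)
  bounds-m 2≤m = subst (λ ℓ → ∃[ k ] (IsM k × 1 ⊔ (ℓ ∸ p) ≤ k × k ≤ ℓ ∸ 1)) (leafCount≡m 2≤m)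
    (bounds (subst (2 ≤_) (sym (leafCount≡m 2≤m)) 2≤m))

  -- When all spokes share their labels, a single class suffices in `edges≤∣R∣+classes`, which
  -- matches the general upper bound.
  isM-upper : 2 ≤ m → (∀ i j → class i ≡ class j) → IsM (m ∸ 1)
  isM-upper 2≤m constant =
    let k , isM@((R , resolving , ∣R∣≡k) , _) , _ , k≤m-1 = bounds-m 2≤m
        m≤1+∣R∣ = subst (m ≤_) (ℕ.+-comm ∣ R ∣ 1)
          (edges≤∣R∣+classes {q = 1} (λ _ → zero) (λ i j _ → same-times i j) resolving)
    in subst IsM (ℕ.≤-antisym k≤m-1 (subst (m ∸ 1 ≤_) ∣R∣≡k (ℕ.m≤n+o⇒m∸n≤o m 1 m≤1+∣R∣))) isM
    where
    same-times : ∀ i j {t} → times i t → times j t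
    same-times i j {t} = subst (λ c → ∃[ k ] t ≡ suc (toℕ c) + k * p) (constant i j)

  -- A leaf is entered only through its own spoke.
  arrives-at-times : ∀ {s i t} → s ≢ suc i → TimedWalk s (suc i) t → times i t
  arrives-at-times s≢i stay = contradiction refl s≢i
  arrives-at-times s≢i (step {w = zero} _ _ l _) = l

  -- A member of `R` tells itself from every other vertex. The leaf of `i₀` separates the rest: it
  -- reaches the centre before any other leaf, and the leaves outside `R` at times from disjoint
  -- label sets.
  leaves-resolve : ∀ {R i₀} → suc i₀ ∈ R →
    (∀ {i j} → ¬ suc i ∈ R → ¬ suc j ∈ R → class i ≡ class j → i ≡ j) → IsResolvingSet R
  leaves-resolve {R} {i₀} i₀∈R injective = isResolvingSet (_ , i₀∈R) separate
    where
    Separated : Rel (Fin (suc m)) 0ℓ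
    Separated u v = ∃[ s ] (s ∈ R × dist s u ≢ dist s v)

    by-itself : ∀ {u v} → u ∈ R → u ≢ v → Separated u v
    by-itself u∈R u≢v = _ , u∈R , λ d≡ → u≢v (dist≡0⇒≡ (trans (sym d≡) (dist-refl _)))

    free≢i₀ : ∀ {i} → ¬ suc i ∈ R → i₀ ≢ i
    free≢i₀ i∉R refl = i∉R i₀∈R

    dist∈times : ∀ {i} → ¬ suc i ∈ R → times i (dist (suc i₀) (suc i))
    dist∈times i∉R = arrives-at-times (free≢i₀ i∉R ∘ suc-injective) (dist-walk _ _)

    off-R : ∀ u v → ¬ u ∈ R → ¬ v ∈ R → u ≢ v → Separated u v
    off-R zero    zero    _   _   u≢v = contradiction refl u≢v
    off-R zero    (suc j) _   j∉R _   =
      _ , i₀∈R , ℕ.<⇒≢ (centre-<-arm λ (j≡i₀ , _) → free≢i₀ j∉R (sym j≡i₀))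
    off-R (suc i) zero    i∉R _   _   =
      _ , i₀∈R , ≢-sym (ℕ.<⇒≢ (centre-<-arm λ (i≡i₀ , _) → free≢i₀ i∉R (sym i≡i₀)))
    off-R (suc i) (suc j) i∉R j∉R i≢j = _ , i₀∈R , λ d≡ → i≢j (cong suc
      (injective i∉R j∉R (times-disjoint (dist∈times i∉R)
        (subst (times j) (sym d≡) (dist∈times j∉R)))))

    separate : ∀ u v → u ≢ v → Separated u v
    separate u v u≢v with u ∈? R | v ∈? R
    ... | yes u∈R | _       = by-itself u∈R u≢v
    ... | no _    | yes v∈R = let s , s∈R , d≢ = by-itself v∈R (≢-sym u≢v) in s , s∈R , ≢-sym d≢
    ... | no u∉R  | no v∉R  = off-R u v u∉R v∉R u≢v

-- The leaves of the first r arms resolve the star as soon as the other f arms have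
-- distinct labels.
module Lower (r f : ℕ) {p : ℕ} (1≤p : 1 ≤ p) (f≤p : f ≤ p) where

  class : Fin (r + f) → Fin p
  -- Arms whose leaf is in the resolving set may share class 0; the others get distinct classes, for
  -- which `f ≤ p` leaves room.
  class i = [ (λ _ → fromℕ< 1≤p) , (λ j → inject≤ j f≤p) ]′ (splitAt r i)

  open PlainStar (r + f) 1≤p class

  leaf : Fin r → Fin (suc (r + f))
  leaf j = suc (j ↑ˡ f)

  private
    left∈ : ∀ {i j} → splitAt r i ≡ inj₁ j → suc i ∈ image leaf
    left∈ i≡ = subst (λ i → suc i ∈ image leaf) (splitAt⁻¹-↑ˡ i≡) (∈-image leaf _)

  class-injective : ∀ {i j} → ¬ suc i ∈ image leaf → ¬ suc j ∈ image leaf →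
                    class i ≡ class j → i ≡ j
  class-injective {i} {j} i∉ j∉ eq with splitAt r i in i≡ | splitAt r j in j≡
  ... | inj₁ _ | _      = contradiction (left∈ i≡) i∉
  ... | inj₂ _ | inj₁ _ = contradiction (left∈ j≡) j∉
  ... | inj₂ a | inj₂ b = trans (sym (splitAt⁻¹-↑ʳ i≡))
    (trans (cong (r ↑ʳ_) (inject≤-injective f≤p f≤p a b eq)) (splitAt⁻¹-↑ʳ j≡))

  smallResolvingSet : 1 ≤ r → ∃[ R ] (Temporal.IsResolvingSet labelling R × ∣ R ∣ ≤ r)
  smallResolvingSet 1≤r =
    image leaf , leaves-resolve (∈-image leaf (fromℕ< 1≤r)) class-injective , ∣image∣≤ leaf

  -- By `r≡`, the `r` chosen leaves are exactly as many as the lower bound requires.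
  isM-lower : 2 ≤ r + f → r ≡ 1 ⊔ ((r + f) ∸ p) → Temporal.IsM labelling (1 ⊔ ((r + f) ∸ p))
  isM-lower 2≤m r≡ =
    let R , resolving , R≤r   = smallResolvingSet (subst (1 ≤_) (sym r≡) (ℕ.m≤m⊔n 1 ((r + f) ∸ p)))
        k , isM , lower≤k , _ = bounds-m 2≤m
    in subst (Temporal.IsM labelling)
         (ℕ.≤-antisym (ℕ.≤-trans (proj₂ isM R resolving) (subst (∣ R ∣ ≤_) r≡ R≤r)) lower≤k) isM

-- The bounds together with their tightness

open Graph using (leafCount)
open Temporal using (IsM)

theorem16 : (∀ (p ℓ : ℕ) → 1 ≤ p → 2 ≤ ℓ →
    ∀ (S : Graph) → IsSubdividedStar S → leafCount S ≡ ℓ →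
    ∀ (Λ : Labelling S) → IsPeriodic1Labelling p Λ →
    ∃[ m ] (IsM Λ m × 1 ⊔ (ℓ ∸ p) ≤ m × m ≤ ℓ ∸ 1))
    × (∀ (p ℓ : ℕ) → 1 ≤ p → 2 ≤ ℓ →
    Σ[ S ∈ Graph ] (IsSubdividedStar S × leafCount S ≡ ℓ ×
    Σ[ Λ ∈ Labelling S ] (IsPeriodic1Labelling p Λ × IsM Λ (1 ⊔ (ℓ ∸ p)))))
    × (∀ (p ℓ : ℕ) → 1 ≤ p → 2 ≤ ℓ →
    Σ[ S ∈ Graph ] (IsSubdividedStar S × leafCount S ≡ ℓ ×
    Σ[ Λ ∈ Labelling S ] (IsPeriodic1Labelling p Λ × IsM Λ (ℓ ∸ 1))))
theorem16 = bounded , lower-attained , upper-attained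
  where
  bounded : ∀ (p ℓ : ℕ) → 1 ≤ p → 2 ≤ ℓ →
    ∀ (S : Graph) → IsSubdividedStar S → leafCount S ≡ ℓ →
    ∀ (Λ : Labelling S) → IsPeriodic1Labelling p Λ →
    ∃[ m ] (IsM Λ m × 1 ⊔ (ℓ ∸ p) ≤ m × m ≤ ℓ ∸ 1)
  bounded p _ 1≤p 2≤ℓ S star refl Λ periodic = Star.Bounds.bounds star Λ 1≤p periodic 2≤ℓ

  lower-attained : ∀ (p ℓ : ℕ) → 1 ≤ p → 2 ≤ ℓ →
    Σ[ S ∈ Graph ] (IsSubdividedStar S × leafCount S ≡ ℓ ×
    Σ[ Λ ∈ Labelling S ] (IsPeriodic1Labelling p Λ × IsM Λ (1 ⊔ (ℓ ∸ p))))
  lower-attained p ℓ 1≤p 2≤ℓ = subst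
    (λ ℓ → Σ[ S ∈ Graph ] (IsSubdividedStar S × leafCount S ≡ ℓ ×
           Σ[ Λ ∈ Labelling S ] (IsPeriodic1Labelling p Λ × IsM Λ (1 ⊔ (ℓ ∸ p)))))
    r+f≡ℓ
    (graph , isStar , leafCount≡m 2≤m , labelling , periodic ,
     isM-lower 2≤m (sym (cong (λ ℓ → 1 ⊔ (ℓ ∸ p)) r+f≡ℓ)))
    where
    -- Taking the lower bound itself for `r` leaves `f` equal to the minimum of `p` and `ℓ - 1`.
    r = 1 ⊔ (ℓ ∸ p)
    f = ℓ ∸ r
    r+f≡ℓ : r + f ≡ ℓ
    r+f≡ℓ = ℕ.m+[n∸m]≡n (ℕ.⊔-lub (ℕ.<⇒≤ 2≤ℓ) (ℕ.m∸n≤m ℓ p))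
    f≤p : f ≤ p
    f≤p = ℕ.m≤n+o⇒m∸n≤o ℓ r (ℕ.≤-trans (ℕ.m≤n+m∸n ℓ p)
      (subst (p + (ℓ ∸ p) ≤_) (ℕ.+-comm p r) (ℕ.+-monoʳ-≤ p (ℕ.m≤n⊔m 1 (ℓ ∸ p)))))
    2≤m = subst (2 ≤_) (sym r+f≡ℓ) 2≤ℓ
    open Lower r f 1≤p f≤p using (class; isM-lower)
    open PlainStar (r + f) 1≤p class using (graph; isStar; leafCount≡m; labelling; periodic)

  upper-attained : ∀ (p ℓ : ℕ) → 1 ≤ p → 2 ≤ ℓ →
    Σ[ S ∈ Graph ] (IsSubdividedStar S × leafCount S ≡ ℓ ×
    Σ[ Λ ∈ Labelling S ] (IsPeriodic1Labelling p Λ × IsM Λ (ℓ ∸ 1)))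
  upper-attained p ℓ 1≤p 2≤ℓ =
    graph , isStar , leafCount≡m 2≤ℓ , labelling , periodic , isM-upper 2≤ℓ (λ _ _ → refl)
    where open PlainStar ℓ 1≤p (λ _ → fromℕ< 1≤p)
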